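{- Let $\mathbf{A}=\langle A,\cdot,\to,\top\rangle$ be a hoop and $\delta\colon A\to A$ a conucleus on $\mathbf{A}$. Let $\mathbf{A}_\delta=\langle \delta(A),\cdot,\to_\delta,\delta(\top)\rangle$ be its conuclear image. The following are equivalent: (i) $\delta(a)=a\cdot\delta(\top)$ for all $a\in A$; (ii) $\delta$ is a homomorphism from $\mathbf{A}$ onto $\mathbf{A}_\delta$. If the equivalent conditions (i) and (ii) hold, then $\mathbf{A}/\ker(\delta)\cong\mathbf{A}_\delta$, and moreover the filter corresponding to the congruence $\ker(\delta)=\{(a,b)\in A^2:\delta(a)=\delta(b)\}$ (that is, the congruence class of $\top$) is the set $\{a\in A:\delta(\top)\le a\}$.
   Context: A hoop is an algebra $\mathbf{A}=\langle A,\cdot,\to,\top\rangle$ such that $\langle A,\cdot,\top\rangle$ is a commutative monoid and $x\to x=\top$, $x\cdot(x\to y)=y\cdot(y\to x)$, $x\to(y\to z)=(x\cdot y)\to z$ for all $x,y,z$. It is partially ordered by $x\le y$ iff $x\to y=\top$; $\top$ is the greatest element. A conucleus on a hoop $\mathbf{A}$ is a map $\delta\colon A\to A$ such that for all $a,b\in A$: $\delta(a)\le a$; $a\le b$ implies $\delta(a)\le\delta(b)$; $\delta(\delta(a))=\delta(a)$; $\delta(a)\cdot\delta(b)\le\delta(a\cdot b)$; $\delta(a)\cdot\delta(\top)=\delta(a)$. The conuclear image is the algebra $\mathbf{A}_\delta=\langle\delta(A),\cdot,\to_\delta,\delta(\top)\rangle$ with $a\to_\delta b:=\delta(a\to b)$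 for $a,b\in\delta(A)$ (the set $\delta(A)$ is closed under $\cdot$; $\mathbf{A}_\delta$ need not be a hoop). Homomorphisms are with respect to the language $\{\cdot,\to,\top\}$, where $\top$ is interpreted in $\mathbf{A}_\delta$ as $\delta(\top)$. A filter of $\mathbf{A}$ is a nonempty upward closed subset closed under $\cdot$; filters correspond to congruences by sending a congruence to the class of $\top$. -}

module Defs where

open import Level using (Level; suc; _⊔_)
open import Algebra.Bundles using (CommutativeMonoid)
open import Algebra.Bundles.Raw using (RawMonoid)
open import Algebra.Core using (Op₁; Op₂)
open import Algebra.Definitions using (Congruent₁; Congruent₂)
open import Algebra.Morphism.Structures using (module MonoidMorphisms)
open import Algebra.Structures using (IsCommutativeMonoid)
open import Data.Product.Base using (Σ; ∃; _×_; _,_; proj₁)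
open import Function.Definitions using (Injective; Surjective)
open import Relation.Binary.Core using (Rel; _⇒_)
open import Relation.Binary.Structures using (IsEquivalence)
open import Relation.Unary using (Pred; Satisfiable)
import Relation.Binary.Reasoning.Setoid as SetoidReasoning

private
  variable
    c c₁ c₂ ℓ ℓ₁ ℓ₂ p : Level

-- The paper's → is written _↦_ .
record RawHoop c ℓ : Set (suc (c ⊔ ℓ)) where
  infixr 5 _↦_
  infixl 7 _·_
  infix  4 _≈_
  field
    Carrier : Set c
    _≈_     : Rel Carrier ℓ
    _·_     : Op₂ Carrier
    _↦_     : Op₂ Carrier
    ⊤       : Carrier

  rawMonoid : RawMonoid c ℓ
  rawMonoid = record { Carrier = Carrier ; _≈_ = _≈_ ; _∙_ = _·_ ; ε = ⊤ }

module _ (A : RawHoop c₁ ℓ₁) (B : RawHoop c₂ ℓ₂) where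
  private
    module A = RawHoop A
    module B = RawHoop B
  open MonoidMorphisms A.rawMonoid B.rawMonoid using (IsMonoidHomomorphism)

  record IsHoopHomomorphism (f : A.Carrier → B.Carrier) : Set (c₁ ⊔ ℓ₁ ⊔ ℓ₂) where
    field
      isMonoidHomomorphism : IsMonoidHomomorphism f
      ↦-homo               : ∀ x y → f (x A.↦ y) B.≈ (f x B.↦ f y)

  record IsHoopIsomorphism (f : A.Carrier → B.Carrier) : Set (c₁ ⊔ c₂ ⊔ ℓ₁ ⊔ ℓ₂) where
    field
      isHoopHomomorphism : IsHoopHomomorphism f
      injective          : Injective A._≈_ B._≈_ f
      surjective         : Surjective A._≈_ B._≈_ f

infix 4 _≅_

_≅_ : RawHoop c₁ ℓ₁ → RawHoop c₂ ℓ₂ → Set (c₁ ⊔ c₂ ⊔ ℓ₁ ⊔ ℓ₂)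
A ≅ B = ∃ (IsHoopIsomorphism A B)

record Hoop c ℓ : Set (suc (c ⊔ ℓ)) where
  infixr 5 _↦_
  infixl 7 _·_
  infix  4 _≈_ _≤_
  field
    Carrier             : Set c
    _≈_                 : Rel Carrier ℓ
    _·_                 : Op₂ Carrier
    _↦_                 : Op₂ Carrier
    ⊤                   : Carrier
    isCommutativeMonoid : IsCommutativeMonoid _≈_ _·_ ⊤
    ↦-cong              : Congruent₂ _≈_ _↦_
    ↦-refl              : ∀ x → x ↦ x ≈ ⊤
    divisibility        : ∀ x y → x · (x ↦ y) ≈ y · (y ↦ x)
    ↦-curry             : ∀ x y z → x ↦ (y ↦ z) ≈ (x · y) ↦ z

  _≤_ : Rel Carrier ℓ
  x ≤ y = x ↦ y ≈ ⊤

  rawHoop : RawHoop c ℓ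
  rawHoop = record { Carrier = Carrier ; _≈_ = _≈_ ; _·_ = _·_ ; _↦_ = _↦_ ; ⊤ = ⊤ }

  commutativeMonoid : CommutativeMonoid c ℓ
  commutativeMonoid = record { isCommutativeMonoid = isCommutativeMonoid }

  open CommutativeMonoid commutativeMonoid public
    using (setoid; isEquivalence; refl; sym; trans)
    renaming ( ∙-cong to ·-cong; ∙-congˡ to ·-congˡ; assoc to ·-assoc
             ; comm to ·-comm; identityˡ to ·-identityˡ; identityʳ to ·-identityʳ )

module HoopProperties (A : Hoop c ℓ) where
  open Hoop A
  open SetoidReasoning setoid

  ≤-antisym : ∀ {x y} → x ≤ y → y ≤ x → x ≈ y
  ≤-antisym {x} {y} x≤y y≤x = begin
    x           ≈⟨ ·-identityʳ x ⟨
    x · ⊤       ≈⟨ ·-congˡ x≤y ⟨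
    x · (x ↦ y) ≈⟨ divisibility x y ⟩
    y · (y ↦ x) ≈⟨ ·-congˡ y≤x ⟩
    y · ⊤       ≈⟨ ·-identityʳ y ⟩
    y           ∎

  ≤-respˡ-≈ : ∀ {x y z} → x ≈ y → x ≤ z → y ≤ z
  ≤-respˡ-≈ x≈y x≤z = trans (↦-cong (sym x≈y) refl) x≤z

  ⊤↦x≈x·[x↦⊤] : ∀ x → ⊤ ↦ x ≈ x · (x ↦ ⊤)
  ⊤↦x≈x·[x↦⊤] x = trans (sym (·-identityˡ _)) (divisibility ⊤ x)

  x≤⊤↦x : ∀ x → x ≤ ⊤ ↦ x
  x≤⊤↦x x = begin
    x ↦ (⊤ ↦ x) ≈⟨ ↦-curry x ⊤ x ⟩
    (x · ⊤) ↦ x ≈⟨ ↦-cong (·-identityʳ x) refl ⟩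
    x ↦ x       ≈⟨ ↦-refl x ⟩
    ⊤           ∎

  ⊤↦x≈x : ∀ x → ⊤ ↦ x ≈ x
  ⊤↦x≈x x = sym (begin
    x                         ≈⟨ ·-identityʳ x ⟨
    x · ⊤                     ≈⟨ ·-congˡ (x≤⊤↦x x) ⟨
    x · (x ↦ (⊤ ↦ x))         ≈⟨ divisibility x (⊤ ↦ x) ⟩
    (⊤ ↦ x) · ((⊤ ↦ x) ↦ x)   ≈⟨ ·-cong (⊤↦x≈x·[x↦⊤] x) lemma ⟩
    (x · t) · (t ↦ ⊤)         ≈⟨ ·-assoc x t (t ↦ ⊤) ⟩
    x · (t · (t ↦ ⊤))         ≈⟨ ·-congˡ (⊤↦x≈x·[x↦⊤] t) ⟨
    x · (⊤ ↦ t)               ≈⟨ ·-congˡ (↦-curry ⊤ x ⊤) ⟩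
    x · ((⊤ · x) ↦ ⊤)         ≈⟨ ·-congˡ (↦-cong (·-identityˡ x) refl) ⟩
    x · t                     ≈⟨ ⊤↦x≈x·[x↦⊤] x ⟨
    ⊤ ↦ x                     ∎)
    where
    t : Carrier
    t = x ↦ ⊤

    lemma : (⊤ ↦ x) ↦ x ≈ t ↦ ⊤
    lemma = begin
      (⊤ ↦ x) ↦ x  ≈⟨ ↦-cong (trans (⊤↦x≈x·[x↦⊤] x) (·-comm x t)) refl ⟩
      (t · x) ↦ x  ≈⟨ ↦-curry t x x ⟨
      t ↦ (x ↦ x)  ≈⟨ ↦-cong refl (↦-refl x) ⟩
      t ↦ ⊤        ∎

module _ (A : Hoop c ℓ) where
  open Hoop A
  open HoopProperties A

  record IsCongruence (θ : Rel Carrier p) : Set (c ⊔ ℓ ⊔ p) where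
    field
      θ-isEquivalence : IsEquivalence θ
      θ-reflexive     : _≈_ ⇒ θ
      θ-·-cong        : Congruent₂ θ _·_
      θ-↦-cong        : Congruent₂ θ _↦_

  record IsFilter (F : Pred Carrier p) : Set (c ⊔ ℓ ⊔ p) where
    field
      nonempty     : Satisfiable F
      upwardClosed : ∀ {a b} → F a → a ≤ b → F b
      ·-closed     : ∀ {a b} → F a → F b → F (a · b)

  -- There are no quotient types: the quotient by θ keeps the carrier and takes θ as its equality.
  Quotient : (θ : Rel Carrier p) → IsCongruence θ → RawHoop c p
  Quotient θ _ = record { Carrier = Carrier ; _≈_ = θ ; _·_ = _·_ ; _↦_ = _↦_ ; ⊤ = ⊤ }

  Filter : ∀ p → Set (c ⊔ ℓ ⊔ suc p)
  Filter p = Σ (Pred Carrier p) IsFilter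

  filterOf : (θ : Rel Carrier p) → IsCongruence θ → Filter p
  filterOf θ θ-cong = (λ a → θ a ⊤) , record
    { nonempty     = ⊤ , θ.refl
    ; upwardClosed = λ {a} {b} aθ⊤ a≤b →
        θ.trans (θ-reflexive (sym (⊤↦x≈x b)))
          (θ.trans (θ-↦-cong (θ.sym aθ⊤) θ.refl) (θ-reflexive a≤b))
    ; ·-closed     = λ aθ⊤ bθ⊤ →
        θ.trans (θ-·-cong aθ⊤ bθ⊤) (θ-reflexive (·-identityˡ ⊤))
    }
    where
    open IsCongruence θ-cong
    module θ = IsEquivalence θ-isEquivalence

module _ (A : Hoop c ℓ) where
  open Hoop A
  open HoopProperties A

  -- δ-cong is no extra hypothesis: it follows from δ-mono and ≤-antisym.
  record IsConucleus (δ : Op₁ Carrier) : Set (c ⊔ ℓ) where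
    field
      δ-cong       : Congruent₁ _≈_ δ
      δ-deflating  : ∀ a → δ a ≤ a
      δ-mono       : ∀ {a b} → a ≤ b → δ a ≤ δ b
      δ-idem       : ∀ a → δ (δ a) ≈ δ a
      δ-submult    : ∀ a b → δ a · δ b ≤ δ (a · b)
      δ-unit       : ∀ a → δ a · δ ⊤ ≈ δ a

  Ker : Op₁ Carrier → Rel Carrier ℓ
  Ker δ a b = δ a ≈ δ b

  module _ (δ : Op₁ Carrier) (isConucleus : IsConucleus δ) where
    open IsConucleus isConucleus

    Image : Set (c ⊔ ℓ)
    Image = Σ Carrier λ a → ∃ λ x → δ x ≈ a

    toImage : Carrier → Image
    toImage x = δ x , x , refl

    ·-fixed : ∀ x y → δ (δ x · δ y) ≈ δ x · δ y
    ·-fixed x y = ≤-antisym (δ-deflating _)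
      (≤-respˡ-≈ (·-cong (δ-idem x) (δ-idem y)) (δ-submult (δ x) (δ y)))

    conuclearImage : RawHoop (c ⊔ ℓ) ℓ
    conuclearImage = record
      { Carrier = Image
      ; _≈_     = λ u v → proj₁ u ≈ proj₁ v
      ; _·_     = λ { (a , x , δx≈a) (b , y , δy≈b) →
                    a · b , δ x · δ y , trans (·-fixed x y) (·-cong δx≈a δy≈b) }
      ; _↦_     = λ u v → toImage (proj₁ u ↦ proj₁ v)
      ; ⊤       = toImage ⊤
      }

{-# OPTIONS --safe #-}

-- Write e = δ ⊤. If δ a = a · e, then δ is multiplicative because e · e = e, and
-- δ (a ↦ b) = δ (δ a ↦ δ b) because multiplication by e is monotone for ↦ and, conversely,
-- a · (e · (a · e ↦ b · e)) ≤ b. If δ is a homomorphism, then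
-- δ (a ↦ δ a) = δ (δ a ↦ δ (δ a)) = e, so e ≤ a ↦ δ a, which is the nontrivial half
-- a · e ≤ δ a of (i).
module Submission where

open import Defs
open import Level using (Level)
open import Algebra.Core using (Op₁)
open import Data.Product.Base using (Σ; _×_; _,_; proj₁)
open import Function.Bundles using (_⇔_; mk⇔)
open import Function.Definitions using (Surjective)
open import Relation.Unary using (_≐_)
open import Algebra.Morphism.Structures using (module MonoidMorphisms)
import Relation.Binary.Reasoning.Setoid as SetoidReasoning

private
  variable
    c ℓ : Level

module HoopOrder (A : Hoop c ℓ) where
  open Hoop A
  open HoopProperties A
  open SetoidReasoning setoid

  -- Divisibility with `⊤` gives `x ≈ x · t` for `t = x ↦ ⊤`. Substituting this into `t` itself and
  -- currying yields `t ↦ t`.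
  x≤⊤ : ∀ x → x ≤ ⊤
  x≤⊤ x = begin
    t               ≈⟨ ↦-cong (trans (sym (⊤↦x≈x x)) (⊤↦x≈x·[x↦⊤] x)) refl ⟩
    (x · t) ↦ ⊤     ≈⟨ ↦-cong (·-comm x t) refl ⟩
    (t · x) ↦ ⊤     ≈⟨ ↦-curry t x ⊤ ⟨
    t ↦ t           ≈⟨ ↦-refl t ⟩
    ⊤               ∎
    where
    t : Carrier
    t = x ↦ ⊤

  ≤-reflexive : ∀ {x y} → x ≈ y → x ≤ y
  ≤-reflexive {x} {y} x≈y = trans (↦-cong x≈y refl) (↦-refl y)

  ≤-respʳ-≈ : ∀ {x y z} → y ≈ z → x ≤ y → x ≤ z
  ≤-respʳ-≈ y≈z x≤y = trans (↦-cong refl (sym y≈z)) x≤y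

  -- When `x ≤ y`, divisibility exhibits `x` as the multiple `y · (y ↦ x)` of `y`; currying then
  -- exposes `y ↦ z`, which is `⊤`.
  ≤-trans : ∀ {x y z} → x ≤ y → y ≤ z → x ≤ z
  ≤-trans {x} {y} {z} x≤y y≤z = begin
    x ↦ z               ≈⟨ ↦-cong (·-identityʳ x) refl ⟨
    (x · ⊤) ↦ z         ≈⟨ ↦-cong (·-congˡ x≤y) refl ⟨
    (x · (x ↦ y)) ↦ z   ≈⟨ ↦-cong (divisibility x y) refl ⟩
    (y · (y ↦ x)) ↦ z   ≈⟨ ↦-cong (·-comm y (y ↦ x)) refl ⟩
    ((y ↦ x) · y) ↦ z   ≈⟨ ↦-curry (y ↦ x) y z ⟨
    (y ↦ x) ↦ (y ↦ z)   ≈⟨ ↦-cong refl y≤z ⟩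
    (y ↦ x) ↦ ⊤         ≈⟨ x≤⊤ (y ↦ x) ⟩
    ⊤                   ∎

  residuate : ∀ {x y z} → x · y ≤ z → x ≤ y ↦ z
  residuate {x} {y} {z} = trans (↦-curry x y z)

  unresiduate : ∀ {x y z} → x ≤ y ↦ z → x · y ≤ z
  unresiduate {x} {y} {z} = trans (sym (↦-curry x y z))

  ·-monoˡ-≤ : ∀ {x y} z → x ≤ y → x · z ≤ y · z
  ·-monoˡ-≤ z x≤y = unresiduate (≤-trans x≤y (residuate (↦-refl _)))

  -- Multiply `(x ↦ y) · x ≤ y` by `z` and residuate.
  [x↦y]≤[x·z↦y·z] : ∀ x y z → x ↦ y ≤ x · z ↦ y · z
  [x↦y]≤[x·z↦y·z] x y z = residuate
    (≤-respˡ-≈ (·-assoc (x ↦ y) x z) (·-monoˡ-≤ z (unresiduate (↦-refl (x ↦ y)))))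

module Conucleus (A : Hoop c ℓ) (δ : Op₁ (Hoop.Carrier A)) (isConucleus : IsConucleus A δ) where
  open Hoop A
  open HoopProperties A
  open HoopOrder A
  open IsConucleus isConucleus
  open SetoidReasoning setoid

  Aδ : RawHoop _ _
  Aδ = conuclearImage A δ isConucleus

  f : Carrier → RawHoop.Carrier Aδ
  f = toImage A δ isConucleus

  open MonoidMorphisms (RawHoop.rawMonoid rawHoop) (RawHoop.rawMonoid Aδ)
    using (module IsMonoidHomomorphism)

  toImage-surjective : Surjective _≈_ (RawHoop._≈_ Aδ) f
  toImage-surjective (_ , x , δx≈a) = x , λ z≈x → trans (δ-cong z≈x) δx≈a

  module _ (δ≈·δ⊤ : ∀ a → δ a ≈ a · δ ⊤) where

    δ-homo : ∀ x y → δ (x · y) ≈ δ x · δ y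
    δ-homo x y = begin
      δ (x · y)        ≈⟨ δ≈·δ⊤ (x · y) ⟩
      (x · y) · δ ⊤    ≈⟨ ·-assoc x y (δ ⊤) ⟩
      x · (y · δ ⊤)    ≈⟨ ·-congˡ (δ≈·δ⊤ y) ⟨
      -- `δ y` absorbs `δ ⊤`, so a second copy can be split off to turn `x` into `δ x`.
      x · δ y          ≈⟨ ·-congˡ (trans (·-comm (δ ⊤) (δ y)) (δ-unit y)) ⟨
      x · (δ ⊤ · δ y)  ≈⟨ ·-assoc x (δ ⊤) (δ y) ⟨
      (x · δ ⊤) · δ y  ≈⟨ ·-cong (δ≈·δ⊤ x) refl ⟨
      δ x · δ y        ∎

    δ-↦-homo : ∀ x y → δ (x ↦ y) ≈ δ (δ x ↦ δ y)
    δ-↦-homo x y = ≤-antisym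
      (δ-mono (≤-respʳ-≈ (↦-cong (sym (δ≈·δ⊤ x)) (sym (δ≈·δ⊤ y)))
        ([x↦y]≤[x·z↦y·z] x y (δ ⊤))))
      -- Since `δ w ≈ δ (δ w)`, monotonicity reduces the goal to `δ w ≤ x ↦ y`.
      (≤-respˡ-≈ (δ-idem w) (δ-mono (residuate δw·x≤y)))
      where
      w : Carrier
      w = δ x ↦ δ y

      -- The factor `δ ⊤` moves from `w` to `x`, so the product equals `w · δ x`, which lies below
      -- `δ y`.
      δw·x≤y : δ w · x ≤ y
      δw·x≤y = ≤-respˡ-≈
        (begin
          w · δ x        ≈⟨ ·-congˡ (trans (δ≈·δ⊤ x) (·-comm x (δ ⊤))) ⟩
          w · (δ ⊤ · x)  ≈⟨ ·-assoc w (δ ⊤) x ⟨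
          (w · δ ⊤) · x  ≈⟨ ·-cong (δ≈·δ⊤ w) refl ⟨
          δ w · x        ∎)
        (≤-trans (unresiduate (↦-refl w)) (δ-deflating y))

    toImage-isHoopHomomorphism : IsHoopHomomorphism rawHoop Aδ f
    toImage-isHoopHomomorphism = record
      { isMonoidHomomorphism = record
        { isMagmaHomomorphism = record
          { isRelHomomorphism = record { cong = δ-cong }
          ; homo              = δ-homo
          }
        ; ε-homo = refl
        }
      ; ↦-homo = δ-↦-homo
      }

  module _ (isHom : IsHoopHomomorphism rawHoop Aδ f) where
    open IsHoopHomomorphism isHom
    open IsMonoidHomomorphism isMonoidHomomorphism using (homo; ε-homo)

    homomorphism⇒δ≈·δ⊤ : ∀ a → δ a ≈ a · δ ⊤
    homomorphism⇒δ≈·δ⊤ a = ≤-antisym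
      -- This half holds for every conucleus: `δ a ≈ δ a · δ ⊤ ≤ a · δ ⊤`.
      (≤-respˡ-≈ (δ-unit a) (·-monoˡ-≤ (δ ⊤) (δ-deflating a)))
      (≤-respˡ-≈ (·-comm (δ ⊤) a)
        (unresiduate (≤-respˡ-≈ δ[a↦δa]≈δ⊤ (δ-deflating (a ↦ δ a)))))
      where
      δ[a↦δa]≈δ⊤ : δ (a ↦ δ a) ≈ δ ⊤
      δ[a↦δa]≈δ⊤ = trans (↦-homo a (δ a)) (δ-cong (≤-reflexive (sym (δ-idem a))))

    -- Compatibility is pulled back along the homomorphism; the `↦` case needs `δ-cong` because
    -- implication in `Aδ` carries an outer `δ`.
    Ker-isCongruence : IsCongruence A (Ker A δ)
    Ker-isCongruence = record
      { θ-isEquivalence = record { refl = refl ; sym = sym ; trans = trans }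
      ; θ-reflexive     = δ-cong
      ; θ-·-cong        = λ p q → trans (homo _ _) (trans (·-cong p q) (sym (homo _ _)))
      ; θ-↦-cong        = λ p q →
          trans (↦-homo _ _) (trans (δ-cong (↦-cong p q)) (sym (↦-homo _ _)))
      }

    -- Equality in the quotient is by definition equality of images under `f`, so well-definedness
    -- and injectivity are identity maps.
    Quotient-Ker≅conuclearImage : Quotient A (Ker A δ) Ker-isCongruence ≅ Aδ
    Quotient-Ker≅conuclearImage = f , record
      { isHoopHomomorphism = record
        { isMonoidHomomorphism = record
          { isMagmaHomomorphism = record
            { isRelHomomorphism = record { cong = λ p → p }
            ; homo              = homo
            }
          ; ε-homo = ε-homo
          }
        ; ↦-homo = ↦-homo
        }
      ; injective  = λ p → p
      ; surjective = λ (_ , x , δx≈a) → x , λ δz≈δx → trans δz≈δx δx≈a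
      }

    -- If `δ a ≈ δ ⊤`, deflation gives `δ ⊤ ≤ a`. Conversely, applying `δ` to `δ ⊤ ≤ a ≤ ⊤` traps
    -- `δ a` between two copies of `δ ⊤`.
    filterOf-Ker≐↑δ⊤ : proj₁ (filterOf A (Ker A δ) Ker-isCongruence) ≐ (λ a → δ ⊤ ≤ a)
    filterOf-Ker≐↑δ⊤ =
        (λ {a} δa≈δ⊤ → ≤-respˡ-≈ δa≈δ⊤ (δ-deflating a))
      , (λ {a} δ⊤≤a → ≤-antisym (δ-mono (x≤⊤ a)) (≤-respˡ-≈ (δ-idem ⊤) (δ-mono δ⊤≤a)))

theorem3p8 :
  ∀ {c ℓ : Level} (A : Hoop c ℓ) (δ : Op₁ (Hoop.Carrier A)) (isConucleus : IsConucleus A δ) →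
  let open Hoop A
      Aδ : RawHoop _ _
      Aδ = conuclearImage A δ isConucleus
      f : Carrier → RawHoop.Carrier Aδ
      f = toImage A δ isConucleus
      cond-i : Set _
      cond-i = ∀ a → δ a ≈ a · δ ⊤
      cond-ii : Set _
      cond-ii = IsHoopHomomorphism rawHoop Aδ f × Surjective _≈_ (RawHoop._≈_ Aδ) f
  in
  (cond-i ⇔ cond-ii)
  × (cond-i × cond-ii →
      Σ (IsCongruence A (Ker A δ)) λ ker-cong →
        (Quotient A (Ker A δ) ker-cong ≅ Aδ)
        × (proj₁ (filterOf A (Ker A δ) ker-cong) ≐ (λ a → δ ⊤ ≤ a)))
theorem3p8 A δ isConucleus =
    mk⇔ (λ i → toImage-isHoopHomomorphism i , toImage-surjective)
        (λ (isHom , _) → homomorphism⇒δ≈·δ⊤ isHom)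
  , λ (_ , isHom , _) →
      Ker-isCongruence isHom , Quotient-Ker≅conuclearImage isHom , filterOf-Ker≐↑δ⊤ isHom
  where open Conucleus A δ isConucleus
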